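{- Let $M\in\{0,1\}^{m\times n}$ be a graphic matrix and let $b\in\{0,1\}^n$ be such that $$M' := \begin{bmatrix} M\\ b^{\intercal}\end{bmatrix} = \begin{bmatrix} M_1 & 0 & \cdots & 0\\ 0 & M_2 & & 0\\ \vdots & & \ddots & \vdots\\ 0 & 0 & \cdots & M_k\\ b_1^{\intercal} & b_2^{\intercal} & \cdots & b_k^{\intercal}\end{bmatrix},$$ where each $M_i$ is a connected matrix (possibly with no rows, in which case it has a single column) and each $b_i\neq 0$. For $i=1,\dots,k$ let $M_i' := \begin{bmatrix} M_i\\ b_i^{\intercal}\end{bmatrix}$. Then $M'$ is graphic if and only if all matrices $M_i'$, $i=1,\dots,k$, are graphic. Moreover, every pair $(G',T')$ with $M'=M(G',T')$ can be obtained as follows. For $i=1,\dots,k$, let $(G_i',T_i')$ be such that $M_i'=M(G_i',T_i')$ holds, and let $e_i'\in T_i'$ be the edge corresponding to the last row of $M_i'$. Let $G_0'$ be a graph with two vertices and exactly $k+1$ edges $e_0,e_1,\dots,e_k$ that connect these two vertices. Obtain $G'$ from $G_0',G_1',\dots,G_k'$ by identifying $e_i$ with $e_i'$ (i.e., identifying their end-vertices via a bijection) for every $i=1,\dots,k$ and then removing these $2k$ edges; correspondingly, $T'=\{e_0\}\cup\bigcup_{i=1}^k (T_i'\setminus\{e_i'\})$. The edge $e_0$ then corresponds to the last row of $M'$.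
   Context: Graphs are finite multigraphs. Let $G$ be a connected multigraph with spanning tree $T \subseteq E(G)$. For $f \in E(G) \setminus T$, the fundamental path $P_f(T) \subseteq T$ is the unique path in $T$ between the end-vertices of $f$. The representation matrix $M(G,T)$ is the binary $|T| \times |E(G)\setminus T|$ matrix, rows indexed by $T$ and columns by $E(G)\setminus T$, whose entry at $(e,f)$ is $1$ if and only if $e \in P_f(T)$. A binary matrix is graphic if it equals $M(G,T)$ for some such pair $(G,T)$. A matrix $A$ is connected if the graph with adjacency matrix $\begin{bmatrix}0 & A\\ A^{\intercal} & 0\end{bmatrix}$ (one vertex for each row and each column, an edge for each nonzero) is connected. -}

module Defs where

open import Data.Bool.Base using (Bool; true; false)
open import Data.Fin.Base using (Fin; zero; suc; _↑ˡ_; _↑ʳ_)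
open import Data.Fin.Properties using (_≟_)
open import Data.Fin.Subset using (Subset; _∈_; ∁; _-_)
open import Data.List.Base as List using (List; []; _∷_; _∷ʳ_)
import Data.List.Membership.DecPropositional as DecMembership
open import Data.List.Relation.Unary.Unique.Propositional using (Unique)
open import Data.Nat.Base using (ℕ; zero; suc; _+_)
open import Data.Product.Base using (Σ; ∃; ∃₂; _×_; _,_; proj₁; proj₂)
open import Data.Sum.Base using (_⊎_; inj₁; inj₂)
open import Data.Vec.Functional as Vector using (Vector; _++_)
open import Function.Base using (const)
open import Function.Bundles using (_⇔_; _↔_; module Inverse)
open import Relation.Binary.Construct.Closure.Equivalence using (EqClosure)
open import Relation.Binary.Construct.Closure.ReflexiveTransitive using (Star)
open import Relation.Binary.PropositionalEquality using (_≡_; _≢_; _≗_)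
open import Relation.Nullary.Decidable using (does)
open import Relation.Nullary.Negation using (¬_)

------------------------------------------------------------------------
-- Binary matrices

Matrix : ℕ → ℕ → Set
Matrix m n = Vector (Vector Bool n) m

addRow : ∀ {m n} → Matrix m n → Vector Bool n → Matrix (m + 1) n
addRow A b = A ++ (b Vector.∷ Vector.[])

oldRow : ∀ {m} → Fin m → Fin (m + 1)
oldRow i = i ↑ˡ 1

lastRow : ∀ {m} → Fin (m + 1)
lastRow {m} = m ↑ʳ zero

NonZeroVector : ∀ {n} → Vector Bool n → Set
NonZeroVector b = ¬ (b ≗ const false)

-- The matrix with blocks 0, A, Aᵀ, 0.
adjacency : ∀ {m n} → Matrix m n → Fin m ⊎ Fin n → Fin m ⊎ Fin n → Bool
adjacency A (inj₁ i) (inj₁ _) = false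
adjacency A (inj₁ i) (inj₂ j) = A i j
adjacency A (inj₂ j) (inj₁ i) = A i j
adjacency A (inj₂ j) (inj₂ _) = false

ConnectedMatrix : ∀ {m n} → Matrix m n → Set
ConnectedMatrix A = ∀ x y → Star (λ u v → adjacency A u v ≡ true) x y

sum : ∀ {k} → Vector ℕ k → ℕ
sum = Vector.foldr _+_ 0

-- The position of the a-th index of block i when blocks of sizes
-- s 0, s 1, … are laid out consecutively.
place : ∀ {k} (s : Vector ℕ k) (i : Fin k) → Fin (s i) → Fin (sum s)
place {suc k} s zero    a = a ↑ˡ sum (Vector.tail s)
place {suc k} s (suc i) a = s zero ↑ʳ place (Vector.tail s) i a

-- A is block diagonal with diagonal blocks Ms i, except for a last row
-- which is the concatenation of the bs i.
record HasBlockForm {k} {r c : Vector ℕ k} (A : Matrix (sum r + 1) (sum c))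
                    (Ms : ∀ i → Matrix (r i) (c i))
                    (bs : ∀ i → Vector Bool (c i)) : Set where
  field
    diagonal    : ∀ i a j → A (oldRow (place r i a)) (place c i j) ≡ Ms i a j
    offDiagonal : ∀ {i i′} → i ≢ i′ → ∀ a j →
                  A (oldRow (place r i a)) (place c i′ j) ≡ false
    bottom      : ∀ i j → A lastRow (place c i j) ≡ bs i j

------------------------------------------------------------------------
-- Multigraphs

-- Loops and parallel edges are allowed.  The order of the two ends
-- of an edge carries no meaning: see Joins.
record Multigraph : Set where
  field
    #V #E : ℕ
    ends  : Fin #E → Fin #V × Fin #V

  Vertex Edge : Set
  Vertex = Fin #V
  Edge   = Fin #E

  Joins : Edge → Vertex → Vertex → Set
  Joins e u v = ends e ≡ (u , v) ⊎ ends e ≡ (v , u)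

open Multigraph public

module _ (G : Multigraph) (T : Subset (#E G)) where

  data Walk : Vertex G → Vertex G → Set where
    nil  : ∀ {u} → Walk u u
    step : ∀ {u v w} (e : Edge G) → e ∈ T → Joins G e u v → Walk v w → Walk u w

module _ {G : Multigraph} {T : Subset (#E G)} where

  edges : ∀ {u v} → Walk G T u v → List (Edge G)
  edges nil            = []
  edges (step e _ _ p) = e ∷ edges p

  -- All vertices visited, except for the final one.
  initVertices : ∀ {u v} → Walk G T u v → List (Vertex G)
  initVertices nil                = []
  initVertices (step {u} _ _ _ p) = u ∷ initVertices p

  vertices : ∀ {u v} → Walk G T u v → List (Vertex G)
  vertices {v = v} p = initVertices p ∷ʳ v

  IsPath : ∀ {u v} → Walk G T u v → Set
  IsPath p = Unique (vertices p)

  -- Loops and pairs of parallel edges give cycles of length 1 and 2.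
  IsCycle : ∀ {u} → Walk G T u u → Set
  IsCycle p = edges p ≢ [] × Unique (edges p) × Unique (initVertices p)

-- T is the edge set of a spanning tree of G, so G itself is connected.
record IsSpanningTree (G : Multigraph) (T : Subset (#E G)) : Set where
  field
    connected : ∀ u v → Σ (Walk G T u v) IsPath
    acyclic   : ∀ {u} (p : Walk G T u u) → ¬ IsCycle p

record TreePair : Set where
  field
    graph          : Multigraph
    tree           : Subset (#E graph)
    isSpanningTree : IsSpanningTree graph tree

  open IsSpanningTree isSpanningTree public

  -- Since the tree is acyclic, a path between two given vertices is
  -- unique, so it does not matter which one connected returns.
  fundamentalPath : (f : Edge graph) →
                    Walk graph tree (proj₁ (ends graph f)) (proj₂ (ends graph f))
  fundamentalPath f = proj₁ (connected (proj₁ (ends graph f)) (proj₂ (ends graph f)))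

  TreeEdge CotreeEdge : Set
  TreeEdge   = ∃ (_∈ tree)
  CotreeEdge = ∃ (_∈ ∁ tree)

  representationMatrix : TreeEdge → CotreeEdge → Bool
  representationMatrix (e , _) (f , _) = does (e ∈? edges (fundamentalPath f))
    where open DecMembership (_≟_ {#E graph}) using (_∈?_)

open TreePair public using (graph; tree; TreeEdge; CotreeEdge; representationMatrix)

-- A = M(G,T), the rows and columns of A being labelled by the edges
-- inside and outside T.
record Represents {m n} (A : Matrix m n) (P : TreePair) : Set where
  field
    rows    : Fin m ↔ TreeEdge P
    cols    : Fin n ↔ CotreeEdge P
    entries : ∀ i j →
              A i j ≡ representationMatrix P (Inverse.to rows i) (Inverse.to cols j)

  rowEdge : Fin m → Edge (graph P)
  rowEdge i = proj₁ (Inverse.to rows i)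

  colEdge : Fin n → Edge (graph P)
  colEdge j = proj₁ (Inverse.to cols j)

open Represents public using (rowEdge; colEdge)

Graphic : ∀ {m n} → Matrix m n → Set
Graphic A = ∃ (Represents A)

------------------------------------------------------------------------
-- Gluing along a bundle of parallel edges

-- Two vertices joined by l parallel edges.
dipole : ℕ → Multigraph
dipole l = record { #V = 2 ; #E = l ; ends = λ _ → zero , suc zero }

-- Graphs Gs i with a distinguished edge es i each.  Piece zero is the
-- dipole, with edges e₀ = zero and eᵢ = suc i; piece suc i is Gs i.
module Gluing {k} (Gs : Vector Multigraph k) (es : ∀ i → Edge (Gs i)) where

  piece : Vector Multigraph (suc k)
  piece = dipole (suc k) Vector.∷ Gs

  UnionVertex UnionEdge : Set
  UnionVertex = ∃ λ h → Vertex (piece h)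
  UnionEdge   = ∃ λ h → Edge (piece h)

  e₀ : UnionEdge
  e₀ = zero , zero

  data Removed : UnionEdge → Set where
    dipoleEdge : ∀ i → Removed (zero , suc i)
    pieceEdge  : ∀ i → Removed (suc i , es i)

  -- A bijection between the ends of eᵢ and those of the non-loop es i
  -- amounts to an ordering (x i , y i) of the ends of es i.
  module _ (x y : ∀ i → Vertex (Gs i)) where

    data Identified : UnionVertex → UnionVertex → Set where
      first  : ∀ i → Identified (zero , zero)     (suc i , x i)
      second : ∀ i → Identified (zero , suc zero) (suc i , y i)

  -- H is, up to isomorphism, the disjoint union of the pieces with the
  -- ends of eᵢ and es i identified and these edges removed: vertex is the
  -- quotient map, and origin e is the edge of the union that becomes e.
  record IsGluing (H : Multigraph) : Set where
    field
      x y        : ∀ i → Vertex (Gs i)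
      x≢y        : ∀ i → x i ≢ y i
      esEnds     : ∀ i → Joins (Gs i) (es i) (x i) (y i)
      vertex     : UnionVertex → Vertex H
      surjective : ∀ v → ∃ λ u → vertex u ≡ v
      kernel     : ∀ u v → vertex u ≡ vertex v ⇔ EqClosure (Identified x y) u v
      origin     : Edge H → UnionEdge
      injective  : ∀ {e f} → origin e ≡ origin f → e ≡ f
      range      : ∀ u → (∃ λ e → origin e ≡ u) ⇔ (¬ Removed u)
      incidence  : ∀ e {h d u v} → origin e ≡ (h , d) → Joins (piece h) d u v →
                   Joins H e (vertex (h , u)) (vertex (h , v))

-- The pair P′ representing A arises from pairs Ps i representing the
-- matrices As i by gluing along the edges of their last rows.
record ObtainedByGluing {k} {r c : Vector ℕ k}
                        {A : Matrix (sum r + 1) (sum c)} {P′ : TreePair}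
                        (R′ : Represents A P′)
                        {As : ∀ i → Matrix (r i + 1) (c i)} {Ps : Vector TreePair k}
                        (Rs : ∀ i → Represents (As i) (Ps i)) : Set where

  open Gluing (λ i → graph (Ps i)) (λ i → rowEdge (Rs i) lastRow)

  field
    isGluing : IsGluing (graph P′)

  open IsGluing isGluing

  field
    treeEdges : ∀ e → e ∈ tree P′ ⇔
                (origin e ≡ e₀ ⊎
                 ∃₂ λ i d → origin e ≡ (suc i , d) ×
                            d ∈ tree (Ps i) - rowEdge (Rs i) lastRow)
    lastLabel : origin (rowEdge R′ lastRow) ≡ e₀
    rowLabels : ∀ i a → origin (rowEdge R′ (oldRow (place r i a)))
                        ≡ (suc i , rowEdge (Rs i) (oldRow a))
    colLabels : ∀ i j → origin (colEdge R′ (place c i j))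
                        ≡ (suc i , colEdge (Rs i) j)

{-# OPTIONS --safe #-}
module Submission where

-- For every edge e of a tree let χₑ : V → Bool tell the two sides of e apart.
-- Then the entry of the representation matrix at (e, f) is the xor of χₑ over
-- the ends of f, a vertex is determined by its values under all the χₑ, and,
-- conversely, any family of functions χₑ such that e is the only tree edge with
-- different values of χₑ at its ends gives a tree pair on the vertices modulo
-- agreement under all χₑ (provided that the tree edges connect these).  Both the gluing and the pieces
-- are obtained in this way: the gluing from the functions of the pieces, each
-- extended by false to the other pieces, and the i-th piece from the functions
-- of the rows of block i and of the last row, which contracts all other tree
-- edges.  With all χₑ normalised to be false at an end of e₀, connectedness of
-- block i and bᵢ ≠ 0 force the χₑ of the other blocks to vanish on its edges, so
-- two pieces share no vertices other than the ends of e₀.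

open import Defs
open import Data.Bool.Base using (Bool; true; false; _xor_)
open import Data.Bool.Properties as Bool using (xor-same; xor-comm; ¬-not)
open import Data.Fin.Base using (Fin; zero; suc; _↑ˡ_; _↑ʳ_; splitAt)
open import Data.Fin.Properties as Fin
  using ( _≟_; any?; all?; splitAt-↑ˡ; splitAt-↑ʳ; splitAt⁻¹-↑ˡ; splitAt⁻¹-↑ʳ
        ; ↑ˡ-injective; ↑ʳ-injective; ¬∀⟶∃¬)
open import Data.Fin.Subset using (Subset; _∈_; _∉_; _-_; inside; outside)
open import Data.Fin.Subset.Properties
  using (x∈∁p⇒x∉p; x∉p⇒x∈∁p; x∈p∧x≢y⇒x∈p-y; p─q⊆p; _∈?_)
import Data.List.Membership.DecPropositional as DecMembership
open import Data.List.Membership.Propositional using ()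
  renaming (_∈_ to _∈ₗ_; _∉_ to _∉ₗ_)
open import Data.List.Relation.Binary.Permutation.Propositional using (↭-sym; ↭⇒↭ₛ)
open import Data.List.Relation.Binary.Permutation.Propositional.Properties using (∷↭∷ʳ)
import Data.List.Relation.Binary.Permutation.Setoid.Properties as Permutation
open import Data.List.Relation.Binary.Subset.Propositional using (_⊆_)
open import Data.List.Relation.Unary.All using ([])
open import Data.List.Relation.Unary.All.Properties using (¬Any⇒All¬)
open import Data.List.Relation.Unary.AllPairs using ([]; _∷_)
open import Data.List.Relation.Unary.Any using (here; there)
open import Data.List.Relation.Unary.Unique.Propositional using (Unique)
open import Data.List.Relation.Unary.Unique.Propositional.Properties
  using (Unique[x∷xs]⇒x∉xs)
open import Data.Maybe.Base using (Maybe; just; nothing)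
open import Data.Maybe.Properties using (just-injective)
open import Data.Nat.Base using (ℕ; zero; suc; _+_)
open import Data.Product.Base as Product using (Σ; ∃; ∃₂; _×_; _,_; proj₁; proj₂)
open import Data.Sum.Base as Sum using (_⊎_; inj₁; inj₂; swap)
open import Data.Vec.Base as Vec using (replicate)
open import Data.Vec.Functional as Vector using (Vector)
open import Data.Vec.Functional.Properties using (lookup-++ˡ; lookup-++ʳ)
open import Data.Vec.Properties as Vec using (lookup-replicate; lookup⇒[]=; []=⇒lookup)
open import Data.Vec.Properties.WithK using ([]=-irrelevant)
open import Function.Base using (_∘_; id)
open import Function.Bundles using (_⇔_; _↔_; mk⇔; mk↔ₛ′; module Inverse)
open import Relation.Binary.Construct.Closure.Equivalence as EqClosure using (EqClosure)
open import Relation.Binary.Construct.Closure.ReflexiveTransitive using (Star; ε; _◅_; _◅◅_)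
open import Relation.Binary.Construct.Closure.Symmetric using (fwd; bwd)
open import Relation.Binary.Definitions using (Reflexive; Symmetric; Decidable)
open import Relation.Binary.PropositionalEquality
open import Relation.Nullary.Decidable using (Dec; does; yes; no; dec-true; dec-false; does-⇔)
open import Relation.Nullary.Negation using (¬_; contradiction)

-- Walks, paths and connectivity avoiding one edge.

module _ {G : Multigraph} where

  Joins-sym : ∀ {e u v} → Joins G e u v → Joins G e v u
  Joins-sym = swap

  Joins-unique : ∀ {e u v a b} → Joins G e u v → Joins G e a b →
                 (a ≡ u × b ≡ v) ⊎ (a ≡ v × b ≡ u)
  Joins-unique (inj₁ p) (inj₁ q) with refl ← trans (sym p) q = inj₁ (refl , refl)
  Joins-unique (inj₁ p) (inj₂ q) with refl ← trans (sym p) q = inj₂ (refl , refl)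
  Joins-unique (inj₂ p) (inj₁ q) with refl ← trans (sym p) q = inj₂ (refl , refl)
  Joins-unique (inj₂ p) (inj₂ q) with refl ← trans (sym p) q = inj₁ (refl , refl)

module _ {G : Multigraph} {T : Subset (#E G)} where

  open DecMembership (_≟_ {#V G}) using () renaming (_∈?_ to _∈ᵥ?_)

  source∈vertices : ∀ {u v} (p : Walk G T u v) → u ∈ₗ vertices p
  source∈vertices nil            = here refl
  source∈vertices (step _ _ _ _) = here refl

  end∈vertices : ∀ {u v} (p : Walk G T u v) {e a b} →
                 e ∈ₗ edges p → Joins G e a b → a ∈ₗ vertices p
  end∈vertices (step f _ j p) (here refl) j′ with Joins-unique {G} j j′
  ... | inj₁ (refl , _) = here refl
  ... | inj₂ (refl , _) = there (source∈vertices p)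
  end∈vertices (step f _ j p) (there e∈p) j′ = there (end∈vertices p e∈p j′)

  edges-unique : ∀ {u v} (p : Walk G T u v) → IsPath p → Unique (edges p)
  edges-unique nil            _              = []
  edges-unique (step e _ j p) (u∉ ∷ path) =
    ¬Any⇒All¬ _ (λ e∈p → Unique[x∷xs]⇒x∉xs (u∉ ∷ path) (end∈vertices p e∈p j))
    ∷ edges-unique p path

  dropUntil : ∀ {u v w} (p : Walk G T u v) → IsPath p → w ∈ₗ vertices p →
              Σ (Walk G T w v) λ q → IsPath q × edges q ⊆ edges p
  dropUntil nil                path       (here refl) = nil , path , λ z → z
  dropUntil p@(step _ _ _ _)   path       (here refl) = p , path , λ z → z
  dropUntil (step _ _ _ p)     (_ ∷ path) (there w∈p)
    with q , q-path , q⊆p ← dropUntil p path w∈p = q , q-path , there ∘ q⊆p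

  -- The inclusion of edge lists is recorded so that a walk avoiding an edge shortens to a path
  -- still avoiding it.
  eraseLoops : ∀ {u v} (p : Walk G T u v) →
               Σ (Walk G T u v) λ q → IsPath q × edges q ⊆ edges p
  eraseLoops nil = nil , [] ∷ [] , λ z → z
  eraseLoops {u} (step e e∈T j p) with eraseLoops p
  ... | q , q-path , q⊆p with u ∈ᵥ? vertices q
  ...   | yes u∈q with q′ , q′-path , q′⊆q ← dropUntil q q-path u∈q =
            q′ , q′-path , there ∘ q⊆p ∘ q′⊆q
  ...   | no  u∉q = step e e∈T j q , ¬Any⇒All¬ _ u∉q ∷ q-path ,
            λ where (here refl) → here refl
                    (there x∈q) → there (q⊆p x∈q)

  -- The equivalence closure of `Link e` is connectivity in `T` without `e`; compared with walks it
  -- makes reversal and concatenation free.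
  Link : Edge G → Vertex G → Vertex G → Set
  Link e a b = ∃ λ f → f ∈ T × f ≢ e × Joins G f a b

  fromWalk : ∀ {e u v} (p : Walk G T u v) → e ∉ₗ edges p → EqClosure (Link e) u v
  fromWalk nil              _    = ε
  fromWalk (step f f∈T j p) e∉p =
    fwd (f , f∈T , (λ f≡e → e∉p (here (sym f≡e))) , j) ◅ fromWalk p (e∉p ∘ there)

  toWalk : ∀ {e u v} → EqClosure (Link e) u v → Σ (Walk G T u v) λ p → e ∉ₗ edges p
  toWalk ε = nil , λ ()
  toWalk (fwd (f , f∈T , f≢e , j) ◅ ls) with p , e∉p ← toWalk ls =
    step f f∈T j p ,
    λ where (here e≡f)  → f≢e (sym e≡f)
            (there e∈p) → e∉p e∈p
  toWalk (bwd (f , f∈T , f≢e , j) ◅ ls) with p , e∉p ← toWalk ls =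
    step f f∈T (Joins-sym {G} j) p ,
    λ where (here e≡f)  → f≢e (sym e≡f)
            (there e∈p) → e∉p e∈p

  -- A connection of the ends of `e` that avoids `e` shortens to a path, and `e` closes this path to
  -- a cycle.
  no-bypass : (∀ {u} (p : Walk G T u u) → ¬ IsCycle p) →
              ∀ {e u v} → e ∈ T → Joins G e u v → ¬ EqClosure (Link e) v u
  no-bypass acyclic {e} e∈T j ls
    with p , e∉p ← toWalk ls
    with q , q-path , q⊆p ← eraseLoops p =
    acyclic (step e e∈T j q)
      ( (λ ())
      , ¬Any⇒All¬ _ (e∉p ∘ q⊆p) ∷ edges-unique q q-path
      , Permutation.Unique-resp-↭ (setoid _)
          (↭⇒↭ₛ (↭-sym (∷↭∷ʳ _ (initVertices q)))) q-path
      )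

-- Fundamental cuts of a tree.

-- χ indicates one of the two sides into which T falls apart when its
-- edge e is deleted.
record Cut (G : Multigraph) (T : Subset (#E G)) (e : Edge G)
           (χ : Vertex G → Bool) : Set where
  field
    constant  : ∀ {f u v} → f ∈ T → f ≢ e → Joins G f u v → χ u ≡ χ v
    separates : ∀ {u v} → Joins G e u v → χ u xor χ v ≡ true

open Cut

xor≡false : ∀ {a b} → a xor b ≡ false → a ≡ b
xor≡false {false} eq = sym eq
xor≡false {true} {true} _ = refl

xor-cancelˡ : ∀ a b c → (a xor b) xor (a xor c) ≡ b xor c
xor-cancelˡ false _     _     = refl
xor-cancelˡ true  false false = refl
xor-cancelˡ true  false true  = refl
xor-cancelˡ true  true  _     = refl

module _ {G : Multigraph} {T : Subset (#E G)} where

  open DecMembership (_≟_ {#E G}) using () renaming (_∈?_ to _∈ₗ?_)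

  xor-isCut : ∀ {e χ} b → Cut G T e χ → Cut G T e (λ v → b xor χ v)
  xor-isCut b isCut = record
    { constant  = λ f∈T f≢e j → cong (b xor_) (constant isCut f∈T f≢e j)
    ; separates = λ j → trans (xor-cancelˡ b _ _) (separates isCut j)
    }

  -- A path from `u` can use an edge at `u` only as its first edge, since a later use would revisit
  -- `u`. For the same reason the rest of the path avoids `e`.
  beyond : ∀ {e u v w} (p : Walk G T u w) → IsPath p → Joins G e u v →
           e ∈ₗ edges p → EqClosure (Link {G} {T} e) v w
  beyond (step f _ j′ p) path@(_ ∷ _) j (there e∈p) =
    contradiction (end∈vertices p e∈p j) (Unique[x∷xs]⇒x∉xs path)
  beyond (step f _ j′ p) path@(_ ∷ _) j (here refl) with Joins-unique {G} j′ j
  ... | inj₁ (_ , refl) =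
        fromWalk p (λ e∈p → Unique[x∷xs]⇒x∉xs path (end∈vertices p e∈p j))
  ... | inj₂ (refl , _) = contradiction (source∈vertices p) (Unique[x∷xs]⇒x∉xs path)

  -- The side of `w` is read off from whether the chosen path from `u` to `w` uses `e`: if so, `w`
  -- is connected to `v` without `e`, and otherwise to `u`. A tree edge other than `e` between the
  -- two sides would then bypass `e`.
  cutOf : IsSpanningTree G T → ∀ {e} → e ∈ T → ∃ (Cut G T e)
  cutOf st {e} e∈T = χ , record { constant = constant′ ; separates = separates′ }
    where
    open IsSpanningTree st
    u = proj₁ (ends G e)
    v = proj₂ (ends G e)
    _~_ = EqClosure (Link {G} {T} e)

    ~-sym : ∀ {a b} → a ~ b → b ~ a
    ~-sym = EqClosure.symmetric _

    v≁u : ¬ (v ~ u)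
    v≁u = no-bypass acyclic e∈T (inj₁ refl)

    χ : Vertex G → Bool
    χ w = does (e ∈ₗ? edges (proj₁ (connected u w)))

    side : ∀ w → (χ w ≡ true × v ~ w) ⊎ (χ w ≡ false × u ~ w)
    side w with p , path ← connected u w with e ∈ₗ? edges p
    ... | yes e∈p = inj₁ (refl , beyond p path (inj₁ refl) e∈p)
    ... | no  e∉p = inj₂ (refl , fromWalk p e∉p)

    constant′ : ∀ {f a b} → f ∈ T → f ≢ e → Joins G f a b → χ a ≡ χ b
    constant′ {f} {a} {b} f∈T f≢e j with side a | side b
    ... | inj₁ (p , _) | inj₁ (q , _) = trans p (sym q)
    ... | inj₂ (p , _) | inj₂ (q , _) = trans p (sym q)
    ... | inj₁ (_ , p) | inj₂ (_ , q) =
          contradiction (p ◅◅ fwd (f , f∈T , f≢e , j) ◅ ~-sym q) v≁u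
    ... | inj₂ (_ , p) | inj₁ (_ , q) =
          contradiction (q ◅◅ bwd (f , f∈T , f≢e , j) ◅ ~-sym p) v≁u

    χu : χ u ≡ false
    χu with side u
    ... | inj₁ (_ , p) = contradiction p v≁u
    ... | inj₂ (p , _) = p

    χv : χ v ≡ true
    χv with side v
    ... | inj₁ (p , _) = p
    ... | inj₂ (_ , p) = contradiction (~-sym p) v≁u

    separates′ : ∀ {a b} → Joins G e a b → χ a xor χ b ≡ true
    separates′ (inj₁ refl) = cong₂ _xor_ χu χv
    separates′ (inj₂ refl) = cong₂ _xor_ χv χu

  constant-along : ∀ {e χ} → Cut G T e χ → ∀ {u v} (p : Walk G T u v) →
                   e ∉ₗ edges p → χ u ≡ χ v
  constant-along cut nil              e∉p = refl
  constant-along cut (step f f∈T j p) e∉p =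
    trans (constant cut f∈T (λ f≡e → e∉p (here (sym f≡e))) j)
          (constant-along cut p (e∉p ∘ there))

  -- Only `e` changes sides, and a walk without repeated edges uses it at most once. For fundamental
  -- paths this turns matrix entries into values of cuts at the ends of cotree edges.
  crossing : ∀ {e χ} → Cut G T e χ → ∀ {u v} (p : Walk G T u v) →
             Unique (edges p) → χ u xor χ v ≡ does (e ∈ₗ? edges p)
  crossing {χ = χ} cut {u} nil _ = xor-same (χ u)
  crossing {e} {χ} cut (step {u} {v} {w} f f∈T j p) unique@(_ ∷ unique′) with e ≟ f
  ... | no e≢f = trans
          (cong (_xor χ w) (constant cut f∈T (e≢f ∘ sym) j))
          (crossing cut p unique′)
  ... | yes refl = trans
          (cong (χ u xor_) (sym (constant-along cut p (Unique[x∷xs]⇒x∉xs unique))))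
          (separates cut j)

  edges⊆T : ∀ {u v} (p : Walk G T u v) {e} → e ∈ₗ edges p → e ∈ T
  edges⊆T (step _ e∈T _ _) (here refl) = e∈T
  edges⊆T (step _ _ _ p)   (there e∈p) = edges⊆T p e∈p

  agree-along : ∀ {κ : Vertex G → Bool} {u v} (p : Walk G T u v) →
                (∀ {e a b} → e ∈ₗ edges p → Joins G e a b → κ a ≡ κ b) →
                ∀ {e a b} → e ∈ₗ edges p → Joins G e a b → κ a ≡ κ u
  agree-along (step _ _ j p) agree (here refl) j′ with Joins-unique {G} j j′
  ... | inj₁ (refl , _) = refl
  ... | inj₂ (refl , refl) = agree (here refl) j′
  agree-along (step _ _ j p) agree (there e∈p) j′ =
    trans (agree-along p (agree ∘ there) e∈p j′) (sym (agree (here refl) j))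

  -- A cycle crosses the cut of its first edge exactly once, so it could not return to the side on
  -- which it started.
  cuts⇒acyclic : (∀ {e} → e ∈ T → ∃ (Cut G T e)) →
                 ∀ {u} (p : Walk G T u u) → ¬ IsCycle p
  cuts⇒acyclic cuts nil ([]≢[] , _) = []≢[] refl
  cuts⇒acyclic cuts {u} p@(step e e∈T _ _) (_ , unique , _)
    with χ , cut ← cuts e∈T
    with () ← trans (sym (trans (crossing cut p unique)
                                (dec-true (e ∈ₗ? edges p) (here refl))))
                    (xor-same (χ u))

-- The cuts belonging to the rows of a represented matrix.

-- The coboundary of `χ` over the field with two elements.
δ : ∀ {V : Set} → (V → Bool) → V × V → Bool
δ χ (u , v) = χ u xor χ v

module _ {m n} {A : Matrix m n} {P : TreePair} (R : Represents A P) where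

  open Represents R using (rows; cols; entries)

  private
    G : Multigraph
    G = graph P

    T : Subset (#E G)
    T = TreePair.tree P

  open DecMembership (_≟_ {#E G}) using () renaming (_∈?_ to _∈ₗ?_)

  rowEdge∈tree : ∀ i → rowEdge R i ∈ T
  rowEdge∈tree i = proj₂ (Inverse.to rows i)

  colEdge∉tree : ∀ j → colEdge R j ∉ T
  colEdge∉tree j = x∈∁p⇒x∉p (proj₂ (Inverse.to cols j))

  rowEdge≢colEdge : ∀ i j → rowEdge R i ≢ colEdge R j
  rowEdge≢colEdge i j eq = colEdge∉tree j (subst (_∈ T) eq (rowEdge∈tree i))

  to-injective : ∀ {l} {E : Edge G → Set} (I : Fin l ↔ ∃ E) →
                 (∀ {e} (p q : E e) → p ≡ q) →
                 ∀ {i j} → proj₁ (Inverse.to I i) ≡ proj₁ (Inverse.to I j) → i ≡ j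
  to-injective I irr {i} {j} eq =
    trans (sym (Inverse.strictlyInverseʳ I i))
      (trans (cong (Inverse.from I) (pair eq)) (Inverse.strictlyInverseʳ I j))
    where
    pair : ∀ {a b} → proj₁ a ≡ proj₁ b → a ≡ b
    pair {_ , p} {_ , q} refl = cong (_ ,_) (irr p q)

  rowEdge-injective : ∀ {i j} → rowEdge R i ≡ rowEdge R j → i ≡ j
  rowEdge-injective = to-injective rows []=-irrelevant

  colEdge-injective : ∀ {i j} → colEdge R i ≡ colEdge R j → i ≡ j
  colEdge-injective = to-injective cols []=-irrelevant

  rowOf : ∀ {e} → e ∈ T → ∃ λ i → rowEdge R i ≡ e
  rowOf e∈T = _ , cong proj₁ (Inverse.strictlyInverseˡ rows (_ , e∈T))

  rowOrCol : ∀ e → (∃ λ i → rowEdge R i ≡ e) ⊎ (∃ λ j → colEdge R j ≡ e)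
  rowOrCol e with e ∈? T
  ... | yes e∈T = inj₁ (rowOf e∈T)
  ... | no  e∉T = inj₂ (_ , cong proj₁
          (Inverse.strictlyInverseˡ cols (_ , x∉p⇒x∈∁p e∉T)))

  private
    fundamental : ∀ j → Walk G T _ _
    fundamental j = TreePair.fundamentalPath P (colEdge R j)

  one⇒∈ : ∀ {i j} → A i j ≡ true → rowEdge R i ∈ₗ edges (fundamental j)
  one⇒∈ {i} {j} one with rowEdge R i ∈ₗ? edges (fundamental j) | entries i j
  ... | yes e∈p | _    = e∈p
  ... | no  _   | eq with () ← trans (sym eq) one

  ∈⇒one : ∀ {e j} → e ∈ₗ edges (fundamental j) → ∃ λ i → rowEdge R i ≡ e × A i j ≡ true
  ∈⇒one {j = j} e∈p with i , refl ← rowOf (edges⊆T (fundamental j) e∈p) =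
    i , refl , trans (entries i j) (dec-true (_ ∈ₗ? edges (fundamental j)) e∈p)

  private
    someCut : ∀ i → ∃ (Cut G T (rowEdge R i))
    someCut i = cutOf (TreePair.isSpanningTree P) (rowEdge∈tree i)

  abstract
    -- Sides are swapped where necessary so that `root` gets `false`. Everything later relies on
    -- `cut-root` and `cut-isCut` alone, so the path search inside `cutOf` stays sealed.
    cut : Vertex G → Fin m → Vertex G → Bool
    cut root i v = proj₁ (someCut i) root xor proj₁ (someCut i) v

    cut-root : ∀ root i → cut root i root ≡ false
    cut-root root i = xor-same (proj₁ (someCut i) root)

    cut-isCut : ∀ root i → Cut G T (rowEdge R i) (cut root i)
    cut-isCut root i = xor-isCut (proj₁ (someCut i) root) (proj₂ (someCut i))

  module _ (root : Vertex G) where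

    cut-row : ∀ i j {u v} → Joins G (rowEdge R j) u v →
              δ (cut root i) (u , v) ≡ does (i ≟ j)
    cut-row i j joins with i ≟ j
    ... | yes refl = separates (cut-isCut root i) joins
    ... | no  i≢j  = trans
            (cong (_xor _) (constant (cut-isCut root i) (rowEdge∈tree j)
                               (λ eq → i≢j (sym (rowEdge-injective eq))) joins))
            (xor-same (cut root i _))

    cut-col : ∀ i j → δ (cut root i) (ends G (colEdge R j)) ≡ A i j
    cut-col i j with p , path ← TreePair.connected P
                       (proj₁ (ends G (colEdge R j))) (proj₂ (ends G (colEdge R j)))
                in eq
      = trans (crossing (cut-isCut root i) p (edges-unique p path)) (sym
          (trans (entries i j) (cong (λ z → does (_ ∈ₗ? edges (proj₁ z))) eq)))

    -- A nontrivial path from `u` to `v` crosses the cut of its first edge exactly once, which puts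
    -- its ends on different sides.
    cuts-separate : ∀ {u v} → (∀ i → cut root i u ≡ cut root i v) → u ≡ v
    cuts-separate {u} {v} same with TreePair.connected P u v
    ... | nil , _ = refl
    ... | p@(step _ e∈T _ _) , path with i , refl ← rowOf e∈T
        with () ← trans (sym (xor-same (cut root i u))) (trans (cong (cut root i u xor_) (same i))
               (trans (crossing (cut-isCut root i) p (edges-unique p path))
                      (dec-true (_ ∈ₗ? edges p) (here refl))))

  -- Connectedness of the tree as an induction principle, in the form in which `Connecting` is
  -- established later.
  tree-induction : (Q : Vertex G → Set) →
                   (∀ i {u v} → Joins G (rowEdge R i) u v → Q u → Q v) →
                   ∀ u v → Q u → Q v
  tree-induction Q closed u v = along (proj₁ (TreePair.connected P u v))
    where
    along : ∀ {u v} → Walk G T u v → Q u → Q v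
    along nil              q = q
    along (step f f∈T j p) q with i , refl ← rowOf f∈T = along p (closed i j q)

-- Finite quotients and enumerations.

record Quotient {n} (_~_ : Fin n → Fin n → Set) : Set where
  field
    size      : ℕ
    class     : Fin n → Fin size
    rep       : Fin size → Fin n
    rep-class : ∀ a → rep (class a) ~ a
    rep-injective : ∀ {x y} → rep x ~ rep y → x ≡ y

-- Representatives are chosen greedily from the end: `zero` becomes a new one unless it is related
-- to one chosen among the later elements.
quotient : ∀ {n} {_~_ : Fin n → Fin n → Set} →
           Reflexive _~_ → Symmetric _~_ → Decidable _~_ → Quotient _~_
quotient {zero} _ _ _ = record
  { size = 0 ; class = λ () ; rep = λ () ; rep-class = λ ()
  ; rep-injective = λ { {()} } }
quotient {suc n} {_~_} ~-refl ~-sym _~?_ = extend (any? λ x → suc (rep x) ~? zero)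
  where
  open Quotient (quotient {n} {λ a b → suc a ~ suc b} ~-refl ~-sym
                          (λ a b → suc a ~? suc b))
  extend : Dec (∃ λ x → suc (rep x) ~ zero) → Quotient _~_
  extend (yes (x , x~0)) = record
    { size          = size
    ; class         = λ { zero → x ; (suc a) → class a }
    ; rep           = suc ∘ rep
    ; rep-class     = λ { zero → x~0 ; (suc a) → rep-class a }
    ; rep-injective = rep-injective
    }
  extend (no ≁0) = record
    { size          = suc size
    ; class         = λ { zero → zero ; (suc a) → suc (class a) }
    ; rep           = rep′
    ; rep-class     = λ { zero → ~-refl ; (suc a) → rep-class a }
    ; rep-injective = injective _ _
    }
    where
    rep′ : Fin (suc size) → Fin (suc n)
    rep′ zero    = zero
    rep′ (suc x) = suc (rep x)

    injective : ∀ x y → rep′ x ~ rep′ y → x ≡ y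
    injective zero    zero    _ = refl
    injective zero    (suc y) p = contradiction (y , ~-sym p) ≁0
    injective (suc x) zero    p = contradiction (x , p) ≁0
    injective (suc x) (suc y) p = cong suc (rep-injective p)

enumeration : ∀ {l} {E : Set} {Q : E → Set} → (∀ {e} (p q : Q e) → p ≡ q) →
              (f : Fin l → E) → (∀ {i j} → f i ≡ f j → i ≡ j) →
              (∀ i → Q (f i)) → (∀ {e} → Q e → ∃ λ i → f i ≡ e) → Fin l ↔ ∃ Q
enumeration {Q = Q} irr f f-injective f∈Q find = mk↔ₛ′
  (λ i → f i , f∈Q i) (proj₁ ∘ find ∘ proj₂)
  (λ (e , q) → pair (proj₂ (find q))) (λ i → f-injective (proj₂ (find (f∈Q i))))
  where
  pair : ∀ {x y : ∃ Q} → proj₁ x ≡ proj₁ y → x ≡ y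
  pair {_ , p} {_ , q} refl = cong (_ ,_) (irr p q)

-- Reconstruction of a tree pair from its cuts.

-- The vertices of the tree pair are the points of X modulo agreement of
-- all χ i: a tree is determined by the cuts of its edges.
module FromCuts
  {X : Set} {N m n} (point : Fin N → X) (index : X → Fin N)
  (point-index : ∀ x → point (index x) ≡ x)
  (rowEnds : Fin m → X × X) (colEnds : Fin n → X × X) (χ : Fin m → X → Bool)
  (χ-row : ∀ i j → δ (χ i) (rowEnds j) ≡ does (i ≟ j)) where

  infix 4 _≈_
  _≈_ : X → X → Set
  x ≈ y = ∀ i → χ i x ≡ χ i y

  -- Says that the tree edges connect all classes. The quantification over `Q` spares the
  -- applications any walks in the quotient; `walkTo` instantiates `Q` with walks.
  Connecting : Set₁
  Connecting = (Q : X → Set) → (∀ {x y} → x ≈ y → Q x → Q y) →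
               (∀ i {x y} → rowEnds i ≡ (x , y) ⊎ rowEnds i ≡ (y , x) → Q x → Q y) →
               ∀ x y → Q x → Q y

  private
    module Classes = Quotient (quotient {_~_ = λ a b → point a ≈ point b}
      (λ _ → refl) (λ p i → sym (p i))
      (λ a b → all? λ i → χ i (point a) Bool.≟ χ i (point b)))

  class : X → Fin Classes.size
  class = Classes.class ∘ index

  rep : Fin Classes.size → X
  rep = point ∘ Classes.rep

  rep-class : ∀ x → rep (class x) ≈ x
  rep-class x i = trans (Classes.rep-class (index x) i) (cong (χ i) (point-index x))

  class-cong : ∀ {x y} → x ≈ y → class x ≡ class y
  class-cong {x} {y} x≈y = Classes.rep-injective λ i →
    trans (rep-class x i) (trans (x≈y i) (sym (rep-class y i)))

  class-injective : ∀ {x y} → class x ≡ class y → x ≈ y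
  class-injective {x} {y} eq i =
    trans (sym (rep-class x i)) (trans (cong (χ i ∘ rep) eq) (rep-class y i))

  class-rep : ∀ v → class (rep v) ≡ v
  class-rep v = Classes.rep-injective (rep-class (rep v))

  private
    cls₂ : X × X → Fin Classes.size × Fin Classes.size
    cls₂ = Product.map class class

    G : Multigraph
    G = record { #V = Classes.size ; #E = m + n
               ; ends = λ e → cls₂ (Sum.[ rowEnds , colEnds ] (splitAt m e)) }

    row : Fin m → Edge G
    row i = i ↑ˡ n

    col : Fin n → Edge G
    col j = m ↑ʳ j

    T : Subset (m + n)
    T = replicate m inside Vec.++ replicate n outside

    row∈T : ∀ i → row i ∈ T
    row∈T i = lookup⇒[]= _ _ (trans (Vec.lookup-++ˡ (replicate m inside) _ i)
                                    (lookup-replicate i inside))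

    col∉T : ∀ j → col j ∉ T
    col∉T j p with () ← trans (sym ([]=⇒lookup p))
      (trans (Vec.lookup-++ʳ (replicate m inside) _ j) (lookup-replicate j outside))

    ∈T⇒row : ∀ {e} → e ∈ T → ∃ λ i → row i ≡ e
    ∈T⇒row {e} p with splitAt m e in eq
    ... | inj₁ i = i , splitAt⁻¹-↑ˡ eq
    ... | inj₂ j = contradiction (subst (_∈ T) (sym (splitAt⁻¹-↑ʳ eq)) p) (col∉T j)

    ∉T⇒col : ∀ {e} → e ∉ T → ∃ λ j → col j ≡ e
    ∉T⇒col {e} p with splitAt m e in eq
    ... | inj₂ j = j , splitAt⁻¹-↑ʳ eq
    ... | inj₁ i = contradiction (subst (_∈ T) (splitAt⁻¹-↑ˡ eq) (row∈T i)) p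

  ends-row : ∀ i → ends G (row i) ≡ cls₂ (rowEnds i)
  ends-row i = cong (cls₂ ∘ Sum.[ rowEnds , colEnds ]) (splitAt-↑ˡ m i n)

  ends-col : ∀ j → ends G (col j) ≡ cls₂ (colEnds j)
  ends-col j = cong (cls₂ ∘ Sum.[ rowEnds , colEnds ]) (splitAt-↑ʳ m n j)

  private
    δ-rep : ∀ i (p : X × X) → δ (χ i ∘ rep) (cls₂ p) ≡ δ (χ i) p
    δ-rep i (x , y) = cong₂ _xor_ (rep-class x i) (rep-class y i)

    δ-joins : ∀ {f : Fin Classes.size → Bool} {e u v} → Joins G e u v →
              δ f (u , v) ≡ δ f (ends G e)
    δ-joins {f} (inj₁ eq) = cong (δ f) (sym eq)
    δ-joins {f} {u = u} (inj₂ eq) = trans (xor-comm (f u) _) (cong (δ f) (sym eq))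

    δ-row : ∀ i {j u v} → Joins G (row j) u v → δ (χ i ∘ rep) (u , v) ≡ does (i ≟ j)
    δ-row i {j} joins = trans (δ-joins {χ i ∘ rep} joins)
      (trans (cong (δ (χ i ∘ rep)) (ends-row j))
             (trans (δ-rep i (rowEnds j)) (χ-row i j)))

    isCut : ∀ i → Cut G T (row i) (χ i ∘ rep)
    isCut i = record
      { constant  = constant′
      ; separates = λ joins → trans (δ-row i joins) (dec-true (i ≟ i) refl)
      }
      where
      constant′ : ∀ {f u v} → f ∈ T → f ≢ row i → Joins G f u v → χ i (rep u) ≡ χ i (rep v)
      constant′ f∈T f≢ joins with j , refl ← ∈T⇒row f∈T =
        xor≡false (trans (δ-row i joins) (dec-false (i ≟ j) (f≢ ∘ sym ∘ cong row)))

  module _ (connecting : Connecting) where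

    private
      walkTo : ∀ y x → Walk G T (class x) (class y)
      -- The target stays fixed and the source moves from `y` to `x`, because `step` extends a walk
      -- at its front; hence the `swap`.
      walkTo y x = connecting (λ x → Walk G T (class x) (class y))
        (λ eq → subst (λ v → Walk G T v (class y)) (class-cong eq))
        (λ i joined → step (row i) (row∈T i) (Sum.map (lift i) (lift i) (swap joined)))
        y x nil
        where
        lift : ∀ i {p} → rowEnds i ≡ p → ends G (row i) ≡ cls₂ p
        lift i eq = trans (ends-row i) (cong cls₂ eq)

      walk : ∀ u v → Walk G T u v
      walk u v = subst₂ (Walk G T) (class-rep u) (class-rep v) (walkTo (rep v) (rep u))

    treePair : TreePair
    treePair = record
      { graph          = G
      ; tree           = T
      ; isSpanningTree = record
        { connected = λ u v → let p , path , _ = eraseLoops (walk u v) in p , path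
        ; acyclic   = cuts⇒acyclic λ e∈T → let i , eq = ∈T⇒row e∈T in
                        _ , subst (λ e → Cut G T e (χ i ∘ rep)) eq (isCut i)
        }
      }

    represents : ∀ {A : Matrix m n} → (∀ i j → δ (χ i) (colEnds j) ≡ A i j) →
                 Represents A treePair
    represents χ-col = record
      { rows    = enumeration []=-irrelevant row (↑ˡ-injective n _ _) row∈T ∈T⇒row
      ; cols    = enumeration []=-irrelevant col (↑ʳ-injective m _ _)
                    (x∉p⇒x∈∁p ∘ col∉T) (∉T⇒col ∘ x∈∁p⇒x∉p)
      ; entries = λ i j → trans (sym (χ-col i j))
          (trans (sym (δ-rep i (colEnds j)))
          (trans (cong (δ (χ i ∘ rep)) (sym (ends-col j)))
                 (crossing (isCut i) _ (edges-unique _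
                   (proj₂ (TreePair.connected treePair _ _))))))
      }

-- Labels for the rows and columns of block matrices.

Index : ∀ {k} → Vector ℕ k → Set
Index s = ∃ λ i → Fin (s i)

place′ : ∀ {k} (s : Vector ℕ k) → Index s → Fin (sum s)
place′ s (i , a) = place s i a

unplace : ∀ {k} (s : Vector ℕ k) → Fin (sum s) → Index s
unplace {suc k} s x =
  Sum.[ (zero ,_) , Product.map suc id ∘ unplace (Vector.tail s) ] (splitAt (s zero) x)

unplace-place : ∀ {k} (s : Vector ℕ k) (p : Index s) → unplace s (place′ s p) ≡ p
unplace-place {suc k} s (zero , a)
  rewrite splitAt-↑ˡ (s zero) a (sum (Vector.tail s)) = refl
unplace-place {suc k} s (suc i , a)
  rewrite splitAt-↑ʳ (s zero) (sum (Vector.tail s)) (place (Vector.tail s) i a)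
  = cong (Product.map suc id) (unplace-place (Vector.tail s) (i , a))

place-unplace : ∀ {k} (s : Vector ℕ k) x → place′ s (unplace s x) ≡ x
place-unplace {suc k} s x with splitAt (s zero) x in eq
... | inj₁ a = splitAt⁻¹-↑ˡ eq
... | inj₂ y = trans (cong (s zero ↑ʳ_) (place-unplace (Vector.tail s) y)) (splitAt⁻¹-↑ʳ eq)

oldRow-injective : ∀ {m} {i j : Fin m} → oldRow i ≡ oldRow j → i ≡ j
oldRow-injective = ↑ˡ-injective 1 _ _

oldRow≢lastRow : ∀ {m} (i : Fin m) → oldRow i ≢ lastRow
oldRow≢lastRow (suc i) eq = oldRow≢lastRow i (Fin.suc-injective eq)

addRow-old : ∀ {m n} (A : Matrix m n) b i j → addRow A b (oldRow i) j ≡ A i j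
addRow-old A b i j = cong (λ v → v j) (lookup-++ˡ A (b Vector.∷ Vector.[]) i)

addRow-last : ∀ {m n} (A : Matrix m n) b j → addRow A b lastRow j ≡ b j
addRow-last A b j = cong (λ v → v j) (lookup-++ʳ A (b Vector.∷ Vector.[]) zero)

data RowView {m} : Fin (m + 1) → Set where
  old  : ∀ i → RowView (oldRow i)
  last : RowView lastRow

rowView : ∀ {m} (x : Fin (m + 1)) → RowView x
rowView {m} x with splitAt m x in eq
... | inj₁ i    rewrite sym (splitAt⁻¹-↑ˡ eq) = old i
... | inj₂ zero rewrite sym (splitAt⁻¹-↑ʳ {m} eq) = last

module _ {k} (r : Vector ℕ k) where

  -- Rows of a matrix with blocks of r 0, r 1, … rows and a last row, which is
  -- labelled nothing.
  RowLabel : Set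
  RowLabel = Maybe (Index r)

  row : RowLabel → Fin (sum r + 1)
  row nothing  = lastRow
  row (just p) = oldRow (place′ r p)

  rowLabel : Fin (sum r + 1) → RowLabel
  rowLabel x with rowView x
  ... | old y = just (unplace r y)
  ... | last  = nothing

  row-rowLabel : ∀ x → row (rowLabel x) ≡ x
  row-rowLabel x with rowView x
  ... | old y = cong oldRow (place-unplace r y)
  ... | last  = refl

  place-injective : ∀ {p q} → place′ r p ≡ place′ r q → p ≡ q
  place-injective {p} {q} eq =
    trans (sym (unplace-place r p)) (trans (cong (unplace r) eq) (unplace-place r q))

  row-injective : ∀ {l l′} → row l ≡ row l′ → l ≡ l′
  row-injective {nothing} {nothing} _  = refl
  row-injective {nothing} {just _}  eq = contradiction (sym eq) (oldRow≢lastRow _)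
  row-injective {just _}  {nothing} eq = contradiction eq (oldRow≢lastRow _)
  row-injective {just p}  {just q}  eq = cong just (place-injective (oldRow-injective eq))

  rowLabel-row : ∀ l → rowLabel (row l) ≡ l
  rowLabel-row l = row-injective (row-rowLabel (row l))

-- From representations of the blocks to one of the whole matrix.

module Glue {k} {r c : Vector ℕ k} {A : Matrix (sum r + 1) (sum c)}
            {Ms : ∀ i → Matrix (r i) (c i)} {bs : ∀ i → Vector Bool (c i)}
            (blocks : HasBlockForm A Ms bs) {Ps : Vector TreePair k}
            (Rs : ∀ i → Represents (addRow (Ms i) (bs i)) (Ps i)) where

  open HasBlockForm blocks
  open Gluing (λ i → graph (Ps i)) (λ i → rowEdge (Rs i) lastRow)

  V : Fin k → Set
  V i = Vertex (graph (Ps i))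

  x y : ∀ i → V i
  x i = proj₁ (ends (graph (Ps i)) (rowEdge (Rs i) lastRow))
  y i = proj₂ (ends (graph (Ps i)) (rowEdge (Rs i) lastRow))

  pole₀ pole₁ : UnionVertex
  pole₀ = zero , zero
  pole₁ = zero , suc zero

  -- With `x i` as root, every cut of piece `i` is `false` at the vertex to be merged with `pole₀`,
  -- which makes the extension by `false` consistent there.
  χᵢ : ∀ i → Fin (r i + 1) → V i → Bool
  χᵢ i = cut (Rs i) (x i)

  -- Deleting `e₀` from the glued tree splits each piece as deleting its own last edge would, so the
  -- label `nothing` combines the last cuts of all pieces.
  χ : RowLabel r → UnionVertex → Bool
  χ nothing        (zero , zero)     = false
  χ nothing        (zero , suc zero) = true
  χ nothing        (suc i , w)       = χᵢ i lastRow w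
  χ (just _)       (zero , _)        = false
  χ (just (i , a)) (suc j , w) with i ≟ j
  ... | yes refl = χᵢ i (oldRow a) w
  ... | no  _    = false

  rowEnds : RowLabel r → UnionVertex × UnionVertex
  rowEnds nothing        = pole₀ , pole₁
  rowEnds (just (i , a)) = Product.map (suc i ,_) (suc i ,_)
    (ends (graph (Ps i)) (rowEdge (Rs i) (oldRow a)))

  colEnds : Index c → UnionVertex × UnionVertex
  colEnds (i , j) = Product.map (suc i ,_) (suc i ,_)
    (ends (graph (Ps i)) (colEdge (Rs i) j))

  χ-row : ∀ l l′ → δ (χ l) (rowEnds l′) ≡ does (row r l ≟ row r l′)
  χ-row nothing nothing = sym (dec-true (row r nothing ≟ row r nothing) refl)
  χ-row nothing (just (j , a)) = trans (cut-row (Rs j) (x j) lastRow (oldRow a) (inj₁ refl))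
    (trans (dec-false (lastRow ≟ oldRow a) (oldRow≢lastRow a ∘ sym))
           (sym (dec-false (lastRow ≟ _) (oldRow≢lastRow (place r j a) ∘ sym))))
  χ-row (just (i , a)) nothing = sym (dec-false (_ ≟ lastRow) (oldRow≢lastRow (place r i a)))
  χ-row (just (i , a)) (just (j , a′)) with i ≟ j
  ... | no  i≢j  = sym (dec-false (_ ≟ _)
                     λ eq → i≢j (cong proj₁ (place-injective r (oldRow-injective eq))))
  ... | yes refl = trans (cut-row (Rs i) (x i) (oldRow a) (oldRow a′) (inj₁ refl))
    (does-⇔ (mk⇔ (cong (oldRow ∘ place r i) ∘ oldRow-injective)
                 (cong oldRow ∘ same-block ∘ place-injective r ∘ oldRow-injective))
            (oldRow a ≟ oldRow a′) (oldRow (place r i a) ≟ oldRow (place r i a′)))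
    where
    same-block : _≡_ {A = Index r} (i , a) (i , a′) → a ≡ a′
    same-block refl = refl

  χ-col : ∀ l p → δ (χ l) (colEnds p) ≡ A (row r l) (place′ c p)
  χ-col nothing (i , j) = trans (cut-col (Rs i) (x i) lastRow j)
    (trans (addRow-last (Ms i) (bs i) j) (sym (bottom i j)))
  χ-col (just (i , a)) (i′ , j) with i ≟ i′
  ... | no  i≢i′ = sym (offDiagonal i≢i′ a j)
  ... | yes refl = trans (cut-col (Rs i) (x i) (oldRow a) j)
    (trans (addRow-old (Ms i) (bs i) a j) (sym (diagonal i a j)))

  χᵢ-y : ∀ i a → χᵢ i a (y i) ≡ does (a ≟ lastRow)
  χᵢ-y i a = trans (cong (_xor χᵢ i a (y i)) (sym (cut-root (Rs i) (x i) a)))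
                   (cut-row (Rs i) (x i) a lastRow (inj₁ refl))

  -- This and `pole₁≈y` yield the identifications of the gluing: they are not imposed but result
  -- from agreement under all cuts.
  pole₀≈x : ∀ i l → χ l pole₀ ≡ χ l (suc i , x i)
  pole₀≈x i nothing = sym (cut-root (Rs i) (x i) lastRow)
  pole₀≈x i (just (j , a)) with j ≟ i
  ... | yes refl = sym (cut-root (Rs i) (x i) (oldRow a))
  ... | no  _    = refl

  pole₁≈y : ∀ i l → χ l pole₁ ≡ χ l (suc i , y i)
  pole₁≈y i nothing =
    sym (trans (χᵢ-y i lastRow) (dec-true (lastRow {r i} ≟ lastRow) refl))
  pole₁≈y i (just (j , a)) with j ≟ i
  ... | yes refl = sym (trans (χᵢ-y i (oldRow a))
                              (dec-false (_ ≟ lastRow) (oldRow≢lastRow a)))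
  ... | no  _    = refl

  private
    sizes : Vector ℕ (suc k)
    sizes = #V ∘ piece

    module Cuts = FromCuts (unplace sizes) (place′ sizes) (unplace-place sizes)
      (rowEnds ∘ rowLabel r) (colEnds ∘ unplace c) (χ ∘ rowLabel r)
      (λ a b → trans (χ-row (rowLabel r a) (rowLabel r b))
        (cong₂ (λ u v → does (u ≟ v)) (row-rowLabel r a) (row-rowLabel r b)))

  connecting : Cuts.Connecting
  connecting Q resp closed u v = fromPole v ∘ toPole u
    where
    closed′ : ∀ l {a b} → rowEnds l ≡ (a , b) ⊎ rowEnds l ≡ (b , a) → Q a → Q b
    closed′ l joins = closed (row r l)
      (subst (λ l → rowEnds l ≡ _ ⊎ rowEnds l ≡ _) (sym (rowLabel-row r l)) joins)

    Q₀⇒Qx : ∀ i → Q pole₀ → Q (suc i , x i)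
    Q₀⇒Qx i = resp (λ a → pole₀≈x i (rowLabel r a))
    Qx⇒Q₀ : ∀ i → Q (suc i , x i) → Q pole₀
    Qx⇒Q₀ i = resp (λ a → sym (pole₀≈x i (rowLabel r a)))
    Q₁⇒Qy : ∀ i → Q pole₁ → Q (suc i , y i)
    Q₁⇒Qy i = resp (λ a → pole₁≈y i (rowLabel r a))
    Qy⇒Q₁ : ∀ i → Q (suc i , y i) → Q pole₁
    Qy⇒Q₁ i = resp (λ a → sym (pole₁≈y i (rowLabel r a)))

    across : ∀ i a {w w′} → Joins (graph (Ps i)) (rowEdge (Rs i) a) w w′ →
             Q (suc i , w) → Q (suc i , w′)
    across i a joins q with rowView a
    ... | old a′ = closed′ (just (i , a′))
          (Sum.map (cong (Product.map _ _)) (cong (Product.map _ _)) joins) q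
    -- The last edge of a piece is not an edge of the gluing; `e₀` between the poles replaces it.
    across i _ (inj₁ refl) q | last = Q₁⇒Qy i (closed′ nothing (inj₁ refl) (Qx⇒Q₀ i q))
    across i _ (inj₂ refl) q | last = Q₀⇒Qx i (closed′ nothing (inj₂ refl) (Qy⇒Q₁ i q))

    within : ∀ i w w′ → Q (suc i , w) → Q (suc i , w′)
    within i = tree-induction (Rs i) (λ w → Q (suc i , w)) (across i)

    toPole : ∀ u → Q u → Q pole₀
    toPole (zero , zero)     q = q
    toPole (zero , suc zero) q = closed′ nothing (inj₂ refl) q
    toPole (suc i , w)       q = Qx⇒Q₀ i (within i w (x i) q)

    fromPole : ∀ u → Q pole₀ → Q u
    fromPole (zero , zero)     q = q
    fromPole (zero , suc zero) q = closed′ nothing (inj₁ refl) q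
    fromPole (suc i , w)       q = within i (x i) w (Q₀⇒Qx i q)

  glued : Graphic A
  glued = Cuts.treePair connecting , Cuts.represents connecting λ a j →
    trans (χ-col (rowLabel r a) (unplace c j))
          (cong₂ A (row-rowLabel r a) (place-unplace c j))

-- Locating the blocks inside a given representation.

module Split {k} {r c : Vector ℕ k} {A : Matrix (sum r + 1) (sum c)}
             {Ms : ∀ i → Matrix (r i) (c i)} {bs : ∀ i → Vector Bool (c i)}
             (blocks : HasBlockForm A Ms bs)
             (connected : ∀ i → ConnectedMatrix (Ms i))
             (nonzero : ∀ i → NonZeroVector (bs i))
             {P : TreePair} (R : Represents A P) where

  open HasBlockForm blocks

  G : Multigraph
  G = graph P

  rowEdge′ : RowLabel r → Edge G
  rowEdge′ = rowEdge R ∘ row r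

  colEdge′ : Index c → Edge G
  colEdge′ = colEdge R ∘ place′ c

  u v : Vertex G
  u = proj₁ (ends G (rowEdge′ nothing))
  v = proj₂ (ends G (rowEdge′ nothing))

  χ : RowLabel r → Vertex G → Bool
  χ = cut R u ∘ row r

  χ-separates : ∀ {w w′} → (∀ l → χ l w ≡ χ l w′) → w ≡ w′
  χ-separates {w} {w′} same = cuts-separate R u λ x →
    subst (λ x → cut R u x w ≡ cut R u x w′) (row-rowLabel r x) (same (rowLabel r x))

  χ-row : ∀ l {l′ w w′} → l ≢ l′ → Joins G (rowEdge′ l′) w w′ → χ l w ≡ χ l w′
  χ-row l {l′} l≢l′ joins = xor≡false (trans (cut-row R u (row r l) (row r l′) joins)
    (dec-false (_ ≟ _) (l≢l′ ∘ row-injective r)))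

  χ-u : ∀ l → χ l u ≡ false
  χ-u l = cut-root R u (row r l)

  χ-v : ∀ p → χ (just p) v ≡ false
  χ-v p = trans (sym (χ-row (just p) {nothing} (λ ()) (inj₁ refl))) (χ-u (just p))

  χ-v-last : χ nothing v ≡ true
  χ-v-last = trans (cong (_xor χ nothing v) (sym (χ-u nothing)))
    (trans (cut-row R u lastRow lastRow (inj₁ refl))
           (dec-true (row r nothing ≟ row r nothing) refl))

  -- The vertices of `G` that make up piece `i`: deleting a tree edge of another block leaves them
  -- on the side of `u`. Both ends of `e₀` belong to every piece.
  Member : Fin k → Vertex G → Set
  Member i w = ∀ {j} → j ≢ i → ∀ a → χ (just (j , a)) w ≡ false

  member-u : ∀ i → Member i u
  member-u i _ a = χ-u (just (_ , a))

  member-v : ∀ i → Member i v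
  member-v i _ a = χ-v _

  -- All edges of block i lie on the same side of every cut from another
  -- block: by connectedness of the block, since paths of block i avoid the
  -- edge which is cut, and on the side of u, because some path of block i
  -- passes through u.
  module _ {i j} (j≢i : j ≢ i) (a : Fin (r j)) where

    private
      κ : Vertex G → Bool
      κ = χ (just (j , a))

      blockEdge : Fin (r i) ⊎ Fin (c i) → Edge G
      blockEdge (inj₁ b) = rowEdge′ (just (i , b))
      blockEdge (inj₂ f) = colEdge′ (i , f)

      κ-rowEdge : ∀ b {w w′} → Joins G (rowEdge′ (just (i , b))) w w′ → κ w ≡ κ w′
      κ-rowEdge b = χ-row (just (j , a)) λ eq → j≢i (cong proj₁ (just-injective eq))

      κ-colEdge : ∀ f {w w′} → Joins G (colEdge′ (i , f)) w w′ → κ w ≡ κ w′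
      κ-colEdge f = λ { (inj₁ refl) → agree ; (inj₂ refl) → sym agree }
        where
        agree : κ (proj₁ (ends G (colEdge′ (i , f)))) ≡ κ (proj₂ (ends G (colEdge′ (i , f))))
        agree = xor≡false (trans (cut-col R u (row r (just (j , a))) (place c i f))
                                 (offDiagonal j≢i a f))

      κ-path : ∀ f l → A (row r l) (place c i f) ≡ true → ∀ {w w′} →
               Joins G (rowEdge′ l) w w′ →
               κ w ≡ κ (proj₁ (ends G (colEdge′ (i , f))))
      κ-path f l one = agree-along
        (TreePair.fundamentalPath P (colEdge′ (i , f))) agree (one⇒∈ R one)
        where
        agree : ∀ {e w w′} →
                e ∈ₗ edges (TreePair.fundamentalPath P (colEdge′ (i , f))) →
                Joins G e w w′ → κ w ≡ κ w′
        agree e∈p joins with ∈⇒one R {j = place c i f} e∈p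
        ... | x , refl , Ax≡1 with rowLabel r x | row-rowLabel r x
        ...   | l′ | refl = χ-row (just (j , a)) {l′} different joins
          where
          different : just (j , a) ≢ l′
          different refl with () ← trans (sym (offDiagonal j≢i a f)) Ax≡1

      start : Fin (r i) ⊎ Fin (c i) → Vertex G
      start z = proj₁ (ends G (blockEdge z))

      κ-star : ∀ {y z} → Star (λ y z → adjacency (Ms i) y z ≡ true) y z →
               κ (start y) ≡ κ (start z)
      κ-star ε = refl
      κ-star (_◅_ {inj₁ b} {inj₂ f} one s) =
        trans (κ-path f (just (i , b)) (trans (diagonal i b f) one) (inj₁ refl)) (κ-star s)
      κ-star (_◅_ {inj₂ f} {inj₁ b} one s) =
        trans (sym (κ-path f (just (i , b)) (trans (diagonal i b f) one) (inj₁ refl)))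
              (κ-star s)

      κ-start : ∀ z → κ (start z) ≡ false
      κ-start z
        -- A nonzero entry of `bs i` puts `e₀` on the fundamental path of its column, so this path
        -- visits `u`, where `κ` is `false`.
        with f , bf≢0 ← ¬∀⟶∃¬ _ (λ f → bs i f ≡ false) (λ f → bs i f Bool.≟ false) (nonzero i)
        = trans (κ-star (connected i z (inj₂ f)))
            (trans (sym (κ-path f nothing (trans (bottom i f) (¬-not bf≢0)) (inj₁ refl)))
                   (χ-u (just (j , a))))

      κ-end : ∀ {e w w′} → (∀ {w w′} → Joins G e w w′ → κ w ≡ κ w′) →
              κ (proj₁ (ends G e)) ≡ false → Joins G e w w′ → κ w ≡ false
      κ-end agree eq (inj₁ refl) = eq
      κ-end agree eq (inj₂ refl) = trans (agree (inj₂ refl)) eq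

    rowEdge-side : ∀ b {w w′} → Joins G (rowEdge′ (just (i , b))) w w′ → κ w ≡ false
    rowEdge-side b = κ-end (κ-rowEdge b) (κ-start (inj₁ b))

    colEdge-side : ∀ f {w w′} → Joins G (colEdge′ (i , f)) w w′ → κ w ≡ false
    colEdge-side f = κ-end (κ-colEdge f) (κ-start (inj₂ f))

  member-row : ∀ i b {w w′} → Joins G (rowEdge′ (just (i , b))) w w′ → Member i w
  member-row i b joins j≢i a = rowEdge-side j≢i a b joins

  member-col : ∀ i f {w w′} → Joins G (colEdge′ (i , f)) w w′ → Member i w
  member-col i f joins j≢i a = colEdge-side j≢i a f joins

  -- The poles have constructors of their own because for `k = 0` there is no block to contain them.
  data Location (w : Vertex G) : Set where
    at-u  : w ≡ u → Location w
    at-v  : w ≡ v → Location w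
    block : ∀ i → Member i w → Location w

  -- Every vertex other than `u` is entered through some tree edge, and the label of that edge gives
  -- the location.
  locate : ∀ w → Location w
  locate w = tree-induction R Location closed u w (at-u refl)
    where
    closed : ∀ x {w w′} → Joins G (rowEdge R x) w w′ → Location w → Location w′
    closed x joins _ with rowLabel r x | row-rowLabel r x
    closed x (inj₁ refl) _ | nothing | refl = at-v refl
    closed x (inj₂ refl) _ | nothing | refl = at-u refl
    closed x joins       _ | just (i , b) | refl =
      block i (member-row i b (Joins-sym {G} joins))

  -- Membership in two pieces makes the cuts of all blocks vanish at `w`, so the cut of `e₀` alone
  -- decides between `u` and `v`.
  common-vertex : ∀ {i j w} → i ≢ j → Member i w → Member j w → w ≡ u ⊎ w ≡ v
  common-vertex {i} {j} {w} i≢j w∈i w∈j = pole (χ nothing w) refl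
    where
    off : ∀ p → χ (just p) w ≡ false
    off (j′ , a) with j′ ≟ i
    ... | no  j′≢i = w∈i j′≢i a
    ... | yes refl = w∈j i≢j a

    pole : ∀ b → χ nothing w ≡ b → w ≡ u ⊎ w ≡ v
    pole false eq = inj₁ (χ-separates λ where
      nothing  → trans eq (sym (χ-u nothing))
      (just p) → trans (off p) (sym (χ-u (just p))))
    pole true eq = inj₂ (χ-separates λ where
      nothing  → trans eq (sym χ-v-last)
      (just p) → trans (off p) (sym (χ-v p)))

  -- The piece of block `i` as a contraction and its embedding.

  module Piece (i : Fin k) where

    label : Fin (r i + 1) → RowLabel r
    label = (λ a → just (i , a)) Vector.++ (nothing Vector.∷ Vector.[])

    label-old : ∀ a → label (oldRow a) ≡ just (i , a)
    label-old = lookup-++ˡ _ (nothing Vector.∷ Vector.[])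

    label-last : label lastRow ≡ nothing
    label-last = lookup-++ʳ (λ a → just (i , a)) (nothing Vector.∷ Vector.[]) zero

    label-injective : ∀ {x y} → label x ≡ label y → x ≡ y
    label-injective {x} {y} eq with rowView x | rowView y
    ... | old a | old b with refl ← trans (sym (label-old a)) (trans eq (label-old b)) = refl
    ... | old a | last  with () ← trans (sym (label-old a)) (trans eq label-last)
    ... | last  | old b with () ← trans (sym label-last) (trans eq (label-old b))
    ... | last  | last  = refl

    private
      module Cuts = FromCuts id id (λ _ → refl)
        (ends G ∘ rowEdge′ ∘ label) (λ j → ends G (colEdge′ (i , j))) (χ ∘ label)
        (λ x y → trans (cut-row R u (row r (label x)) (row r (label y)) (inj₁ refl))
                       (does-⇔ (mk⇔ (label-injective ∘ row-injective r)
                                    (cong (row r ∘ label)))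
                               (row r (label x) ≟ row r (label y)) (x ≟ y)))

      connecting : Cuts.Connecting
      connecting Q resp closed = tree-induction R Q across
        where
        closed′ : ∀ x {l w w′} → label x ≡ l → Joins G (rowEdge′ l) w w′ → Q w → Q w′
        closed′ x refl = closed x

        across : ∀ x {w w′} → Joins G (rowEdge R x) w w′ → Q w → Q w′
        across x joins with rowLabel r x | row-rowLabel r x
        ... | nothing      | refl = closed′ lastRow label-last joins
        ... | just (j , a) | refl with j ≟ i
        ...   | yes refl = closed′ (oldRow a) (label-old a) joins
        -- No cut of the piece separates the ends of a tree edge from another block, so such an edge
        -- is contracted.
        ...   | no  j≢i  = resp λ x → χ-row (label x) (different x) joins
          where
          different : ∀ x → label x ≢ just (j , a)
          different x eq with rowView x
          ... | old b with refl ← trans (sym (label-old b)) eq = j≢i refl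
          ... | last  with () ← trans (sym label-last) eq

      χ-col : ∀ x j → δ (χ (label x)) (ends G (colEdge′ (i , j))) ≡ addRow (Ms i) (bs i) x j
      χ-col x j = trans (cut-col R u (row r (label x)) (place c i j)) (entry (rowView x))
        where
        entry : ∀ {x} → RowView x → A (row r (label x)) (place c i j) ≡ addRow (Ms i) (bs i) x j
        entry (old a) = trans (cong (λ l → A (row r l) (place c i j)) (label-old a))
          (trans (diagonal i a j) (sym (addRow-old (Ms i) (bs i) a j)))
        entry last    = trans (cong (λ l → A (row r l) (place c i j)) label-last)
          (trans (bottom i j) (sym (addRow-last (Ms i) (bs i) j)))

    open Cuts public using (class; rep; rep-class; class-rep; class-injective)

    Pᵢ : TreePair
    Pᵢ = Cuts.treePair connecting

    Rᵢ : Represents (addRow (Ms i) (bs i)) Pᵢ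
    Rᵢ = Cuts.represents connecting χ-col

    Gᵢ : Multigraph
    Gᵢ = graph Pᵢ

    ends-old : ∀ a → ends Gᵢ (rowEdge Rᵢ (oldRow a)) ≡
                     Product.map class class (ends G (rowEdge′ (just (i , a))))
    ends-old a = trans (Cuts.ends-row (oldRow a))
      (cong (λ l → Product.map class class (ends G (rowEdge′ l))) (label-old a))

    ends-last : ends Gᵢ (rowEdge Rᵢ lastRow) ≡ (class u , class v)
    ends-last = trans (Cuts.ends-row lastRow)
      (cong (λ l → Product.map class class (ends G (rowEdge′ l))) label-last)

    ends-col : ∀ j → ends Gᵢ (colEdge Rᵢ j) ≡
                     Product.map class class (ends G (colEdge′ (i , j)))
    ends-col = Cuts.ends-col

    χ-class : ∀ {w w′} → class w ≡ class w′ → ∀ x → χ (label x) w ≡ χ (label x) w′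
    χ-class = class-injective

    class-u≢class-v : class u ≢ class v
    class-u≢class-v eq with () ←
      trans (sym (χ-u nothing))
        (trans (subst (λ l → χ l u ≡ χ l v) label-last (χ-class eq lastRow)) χ-v-last)

    -- Contracting the tree edges outside of block i moves each vertex into
    -- the piece.
    retract : ∀ w → ∃ λ w′ → Member i w′ × (∀ x → χ (label x) w′ ≡ χ (label x) w)
    retract w with locate w
    ... | at-u refl = w , member-u i , λ _ → refl
    ... | at-v refl = w , member-v i , λ _ → refl
    ... | block j w∈j with j ≟ i
    ...   | yes refl = w , w∈j , λ _ → refl
    -- As a member of piece `j`, `w` has all cuts of block `i` equal to `false`, so the cuts of
    -- piece `i` cannot tell it from one of `u` and `v`.
    ...   | no  j≢i  = pole (χ nothing w) refl
      where
      agree : ∀ w′ → χ nothing w′ ≡ χ nothing w →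
              (∀ a → χ (just (i , a)) w′ ≡ false) →
              ∀ x → χ (label x) w′ ≡ χ (label x) w
      agree w′ eq off x with rowView x
      ... | old a = subst (λ l → χ l w′ ≡ χ l w) (sym (label-old a))
                      (trans (off a) (sym (w∈j (j≢i ∘ sym) a)))
      ... | last  = subst (λ l → χ l w′ ≡ χ l w) (sym label-last) eq

      pole : ∀ b → χ nothing w ≡ b →
             ∃ λ w′ → Member i w′ × (∀ x → χ (label x) w′ ≡ χ (label x) w)
      pole false eq = u , member-u i ,
        agree u (trans (χ-u nothing) (sym eq)) (λ a → χ-u (just (i , a)))
      pole true  eq = v , member-v i , agree v (trans χ-v-last (sym eq)) (λ a → χ-v _)

    embed : Vertex Gᵢ → Vertex G
    embed w = proj₁ (retract (rep w))

    embed-member : ∀ w → Member i (embed w)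
    embed-member w = proj₁ (proj₂ (retract (rep w)))

    χ-embed : ∀ w x → χ (label x) (embed w) ≡ χ (label x) (rep w)
    χ-embed w = proj₂ (proj₂ (retract (rep w)))

    -- The cuts of the piece agree on both sides because the classes do, and those of other blocks
    -- vanish at both since both are members. Thus `embed` identifies the vertices of the piece with
    -- the members.
    embed-class : ∀ {w} → Member i w → embed (class w) ≡ w
    embed-class {w} w∈i = χ-separates agree
      where
      own : ∀ x {l} → label x ≡ l → χ l (embed (class w)) ≡ χ l w
      own x refl = trans (χ-embed (class w) x) (rep-class w x)

      agree : ∀ l → χ l (embed (class w)) ≡ χ l w
      agree nothing = own lastRow label-last
      agree (just (j , a)) with j ≟ i
      ... | yes refl = own (oldRow a) (label-old a)
      ... | no  j≢i  = trans (embed-member (class w) j≢i a) (sym (w∈i j≢i a))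

    embed-injective : ∀ {w w′} → embed w ≡ embed w′ → w ≡ w′
    embed-injective {w} {w′} eq = trans (sym (class-rep w)) (trans
      (Cuts.class-cong λ x → trans (sym (χ-embed w x))
        (trans (cong (χ (label x)) eq) (χ-embed w′ x)))
      (class-rep w′))

  -- The given graph as the gluing of its pieces.

  open Piece using (Pᵢ; Rᵢ; class; embed; embed-class)

  module Union = Gluing (λ i → graph (Pᵢ i)) (λ i → rowEdge (Rᵢ i) lastRow)
  open Union

  EdgeLabel : Set
  EdgeLabel = RowLabel r ⊎ Index c

  edge : EdgeLabel → Edge G
  edge = Sum.[ rowEdge′ , colEdge′ ]

  edgeLabel : Edge G → EdgeLabel
  edgeLabel e = Sum.map (rowLabel r ∘ proj₁) (unplace c ∘ proj₁) (rowOrCol R e)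

  edge-edgeLabel : ∀ e → edge (edgeLabel e) ≡ e
  edge-edgeLabel e with rowOrCol R e
  ... | inj₁ (x , refl) = cong (rowEdge R) (row-rowLabel r x)
  ... | inj₂ (j , refl) = cong (colEdge R) (place-unplace c j)

  edge-injective : ∀ {l l′} → edge l ≡ edge l′ → l ≡ l′
  edge-injective {inj₁ l} {inj₁ l′} eq = cong inj₁ (row-injective r (rowEdge-injective R eq))
  edge-injective {inj₁ l} {inj₂ p}  eq = contradiction eq (rowEdge≢colEdge R _ _)
  edge-injective {inj₂ p} {inj₁ l}  eq = contradiction (sym eq) (rowEdge≢colEdge R _ _)
  edge-injective {inj₂ p} {inj₂ q}  eq = cong inj₂ (place-injective c (colEdge-injective R eq))

  originOf : EdgeLabel → UnionEdge
  originOf (inj₁ nothing)        = e₀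
  originOf (inj₁ (just (i , a))) = suc i , rowEdge (Rᵢ i) (oldRow a)
  originOf (inj₂ (i , j))        = suc i , colEdge (Rᵢ i) j


  piece-injective : ∀ {i d d′} → _≡_ {A = UnionEdge} (suc i , d) (suc i , d′) → d ≡ d′
  piece-injective refl = refl

  originOf-injective : ∀ l l′ → originOf l ≡ originOf l′ → l ≡ l′
  originOf-injective (inj₁ nothing) (inj₁ nothing) _ = refl
  originOf-injective (inj₁ nothing) (inj₁ (just _)) ()
  originOf-injective (inj₁ nothing) (inj₂ _) ()
  originOf-injective (inj₁ (just _)) (inj₁ nothing) ()
  originOf-injective (inj₂ _) (inj₁ nothing) ()
  originOf-injective (inj₁ (just (i , a))) (inj₁ (just (i′ , a′))) eq
    with refl ← Fin.suc-injective (cong proj₁ eq) =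
    cong (λ a → inj₁ (just (i , a)))
         (oldRow-injective (rowEdge-injective (Rᵢ i) (piece-injective eq)))
  originOf-injective (inj₁ (just (i , a))) (inj₂ (i′ , j)) eq
    with refl ← Fin.suc-injective (cong proj₁ eq) =
    contradiction (piece-injective eq) (rowEdge≢colEdge (Rᵢ i) _ _)
  originOf-injective (inj₂ (i , j)) (inj₁ (just (i′ , a))) eq
    with refl ← Fin.suc-injective (cong proj₁ eq) =
    contradiction (sym (piece-injective eq)) (rowEdge≢colEdge (Rᵢ i) _ _)
  originOf-injective (inj₂ (i , j)) (inj₂ (i′ , j′)) eq
    with refl ← Fin.suc-injective (cong proj₁ eq) =
    cong (λ j → inj₂ (i , j)) (colEdge-injective (Rᵢ i) (piece-injective eq))

  origin : Edge G → UnionEdge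
  origin = originOf ∘ edgeLabel

  origin-edge : ∀ l → origin (edge l) ≡ originOf l
  origin-edge l = cong originOf (edge-injective (edge-edgeLabel (edge l)))

  origin-injective : ∀ {e f} → origin e ≡ origin f → e ≡ f
  origin-injective {e} {f} eq = trans (sym (edge-edgeLabel e)) (trans
    (cong edge (originOf-injective (edgeLabel e) (edgeLabel f) eq)) (edge-edgeLabel f))

  kept : ∀ l {d} → originOf l ≡ d → ¬ Removed d
  kept (inj₁ nothing) () (dipoleEdge i)
  kept (inj₁ (just _)) () (dipoleEdge i)
  kept (inj₂ _) () (dipoleEdge i)
  kept (inj₁ nothing) () (pieceEdge i)
  kept (inj₁ (just (i , a))) eq (pieceEdge i′) with refl ← Fin.suc-injective (cong proj₁ eq) =
    oldRow≢lastRow a (rowEdge-injective (Rᵢ i) (piece-injective eq))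
  kept (inj₂ (i , j)) eq (pieceEdge i′) with refl ← Fin.suc-injective (cong proj₁ eq) =
    rowEdge≢colEdge (Rᵢ i) _ _ (sym (piece-injective eq))

  originOf-surjective : ∀ d → ¬ Removed d → ∃ λ l → originOf l ≡ d
  originOf-surjective (zero , zero)  _  = inj₁ nothing , refl
  originOf-surjective (zero , suc i) ¬d = contradiction (dipoleEdge i) ¬d
  originOf-surjective (suc i , d)    ¬d with rowOrCol (Rᵢ i) d
  ... | inj₂ (j , refl) = inj₂ (i , j) , refl
  ... | inj₁ (x , refl) with rowView x
  ...   | old a = inj₁ (just (i , a)) , refl
  ...   | last  = contradiction (pieceEdge i) ¬d

  vertex : UnionVertex → Vertex G
  vertex (zero , zero)     = u
  vertex (zero , suc zero) = v
  vertex (suc i , w)       = embed i w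

  vertex-surjective : ∀ w → ∃ λ z → vertex z ≡ w
  vertex-surjective w with locate w
  ... | at-u refl   = (zero , zero) , refl
  ... | at-v refl   = (zero , suc zero) , refl
  ... | block i w∈i = (suc i , class i w) , embed-class i w∈i

  x y : ∀ i → Vertex (graph (Pᵢ i))
  x i = class i u
  y i = class i v

  _~_ : UnionVertex → UnionVertex → Set
  _~_ = EqClosure (Identified x y)

  ~-sym : ∀ {z z′} → z ~ z′ → z′ ~ z
  ~-sym = EqClosure.symmetric _

  u≢v : u ≢ v
  u≢v eq with () ← trans (sym (χ-u nothing)) (trans (cong (χ nothing) eq) χ-v-last)

  -- By injectivity of `embed`, the only vertex of piece `i` lying over `u` is `x i`.
  vertex≡u : ∀ z → vertex z ≡ u → z ~ (zero , zero)
  vertex≡u (zero , zero)     _  = ε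
  vertex≡u (zero , suc zero) eq = contradiction (sym eq) u≢v
  vertex≡u (suc i , w) eq
    with refl ← Piece.embed-injective i {w} {x i} (trans eq (sym (embed-class i (member-u i))))
    = bwd (first i) ◅ ε

  vertex≡v : ∀ z → vertex z ≡ v → z ~ (zero , suc zero)
  vertex≡v (zero , zero)     eq = contradiction eq u≢v
  vertex≡v (zero , suc zero) _  = ε
  vertex≡v (suc i , w) eq
    with refl ← Piece.embed-injective i {w} {y i} (trans eq (sym (embed-class i (member-v i))))
    = bwd (second i) ◅ ε

  -- Within one piece `embed` is injective; vertices of different pieces with the same image lie
  -- over a pole by `common-vertex` and are identified through it.
  vertex-injective : ∀ z z′ → vertex z ≡ vertex z′ → z ~ z′
  vertex-injective (zero , zero)     z′ eq = ~-sym (vertex≡u z′ (sym eq))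
  vertex-injective (zero , suc zero) z′ eq = ~-sym (vertex≡v z′ (sym eq))
  vertex-injective z@(suc _ , _) (zero , zero)     eq = vertex≡u z eq
  vertex-injective z@(suc _ , _) (zero , suc zero) eq = vertex≡v z eq
  vertex-injective z@(suc i , w) z′@(suc j , w′) eq with i ≟ j
  ... | yes refl with refl ← Piece.embed-injective i {w} {w′} eq = ε
  ... | no  i≢j
    with common-vertex i≢j (Piece.embed-member i w)
           (subst (Member j) (sym eq) (Piece.embed-member j w′))
  ...   | inj₁ w≡u = vertex≡u z w≡u ◅◅ ~-sym (vertex≡u z′ (trans (sym eq) w≡u))
  ...   | inj₂ w≡v = vertex≡v z w≡v ◅◅ ~-sym (vertex≡v z′ (trans (sym eq) w≡v))

  vertex-respects : ∀ {z z′} → z ~ z′ → vertex z ≡ vertex z′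
  vertex-respects = EqClosure.gfold isEquivalence vertex λ where
    (first i)  → sym (embed-class i (member-u i))
    (second i) → sym (embed-class i (member-v i))

  -- The ends of `e` are members of piece `i`, and on members `embed` undoes `class`.
  joins-embed : ∀ i {d e w w′} →
                ends (graph (Pᵢ i)) d ≡ Product.map (class i) (class i) (ends G e) →
                (∀ {w w′} → Joins G e w w′ → Member i w) →
                Joins (graph (Pᵢ i)) d w w′ → Joins G e (embed i w) (embed i w′)
  joins-embed i {e = e} ends≡ member = Sum.map
    (λ eq → same (trans (sym ends≡) eq)) (λ eq → same (trans (sym ends≡) eq))
    where
    same : ∀ {w w′} → Product.map (class i) (class i) (ends G e) ≡ (w , w′) →
           ends G e ≡ (embed i w , embed i w′)
    same refl = cong₂ _,_ (sym (embed-class i (member (inj₁ refl))))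
                          (sym (embed-class i (member (inj₂ refl))))

  incidence : ∀ l {h d w w′} → originOf l ≡ (h , d) → Joins (piece h) d w w′ →
              Joins G (edge l) (vertex (h , w)) (vertex (h , w′))
  incidence (inj₁ nothing) refl (inj₁ refl) = inj₁ refl
  incidence (inj₁ nothing) refl (inj₂ refl) = inj₂ refl
  incidence (inj₁ (just (i , a))) refl = joins-embed i (Piece.ends-old i a) (member-row i a)
  incidence (inj₂ (i , j))        refl = joins-embed i (Piece.ends-col i j) (member-col i j)

  isGluing : IsGluing G
  isGluing = record
    { x          = x
    ; y          = y
    ; x≢y        = Piece.class-u≢class-v
    ; esEnds     = λ i → inj₁ (Piece.ends-last i)
    ; vertex     = vertex
    ; surjective = vertex-surjective
    ; kernel     = λ z z′ → mk⇔ (vertex-injective z z′) vertex-respects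
    ; origin     = origin
    ; injective  = origin-injective
    ; range      = λ d → mk⇔ (λ (e , eq) → kept (edgeLabel e) eq)
                             (λ ¬d → let l , eq = originOf-surjective d ¬d in
                                     edge l , trans (origin-edge l) eq)
    ; incidence  = λ e {h} {_} {w} {w′} eq joins →
        subst (λ e → Joins G e (vertex (h , w)) (vertex (h , w′)))
              (edge-edgeLabel e) (incidence (edgeLabel e) eq joins)
    }

  InTree : UnionEdge → Set
  InTree d = d ≡ e₀ ⊎
    ∃₂ λ i d′ → d ≡ (suc i , d′) × d′ ∈ TreePair.tree (Pᵢ i) - rowEdge (Rᵢ i) lastRow

  edge-inTree : ∀ l → edge l ∈ TreePair.tree P → InTree (originOf l)
  edge-inTree (inj₁ nothing)        _   = inj₁ refl
  edge-inTree (inj₁ (just (i , a))) _   = inj₂ (i , _ , refl ,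
    x∈p∧x≢y⇒x∈p-y (rowEdge∈tree (Rᵢ i) (oldRow a))
                   (oldRow≢lastRow a ∘ rowEdge-injective (Rᵢ i)))
  edge-inTree (inj₂ p)              e∈T = contradiction e∈T (colEdge∉tree R (place′ c p))

  inTree-edge : ∀ l → InTree (originOf l) → edge l ∈ TreePair.tree P
  inTree-edge (inj₁ l)       _         = rowEdge∈tree R (row r l)
  inTree-edge (inj₂ (i , j)) (inj₂ (i′ , d , eq , d∈))
    with refl ← Fin.suc-injective (cong proj₁ eq) =
    contradiction (subst (_∈ _) (sym (piece-injective eq)) (p─q⊆p _ _ d∈))
                  (colEdge∉tree (Rᵢ i) j)

  obtainedByGluing : ObtainedByGluing R Rᵢ
  obtainedByGluing = record
    { isGluing  = isGluing
    ; treeEdges = λ e → mk⇔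
        (λ e∈T → edge-inTree (edgeLabel e) (subst (_∈ _) (sym (edge-edgeLabel e)) e∈T))
        (λ o → subst (_∈ _) (edge-edgeLabel e) (inTree-edge (edgeLabel e) o))
    ; lastLabel = origin-edge (inj₁ nothing)
    ; rowLabels = λ i a → origin-edge (inj₁ (just (i , a)))
    ; colLabels = λ i j → origin-edge (inj₂ (i , j))
    }

theorem3 : ∀ {k} (r c : Vector ℕ k)
    (M : Matrix (sum r) (sum c)) (b : Vector Bool (sum c))
    (Ms : (i : Fin k) → Matrix (r i) (c i))
    (bs : (i : Fin k) → Vector Bool (c i)) →
    Graphic M →
    HasBlockForm (addRow M b) Ms bs →
    (∀ i → ConnectedMatrix (Ms i)) →
    (∀ i → NonZeroVector (bs i)) →
    (Graphic (addRow M b) ⇔ (∀ i → Graphic (addRow (Ms i) (bs i))))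
    ×
    (∀ (P′ : TreePair) (R′ : Represents (addRow M b) P′) →
    Σ (Vector TreePair k) λ Ps →
    Σ (∀ i → Represents (addRow (Ms i) (bs i)) (Ps i)) λ Rs →
    ObtainedByGluing R′ Rs)
theorem3 r c M b Ms bs _ blocks connected nonzero =
  -- The pieces cut out of a representation serve both the forward implication and the description
  -- of all representations.
  mk⇔ (λ (_ , R′) i → _ , Rᵢ R′ i) (λ graphic → Glue.glued blocks (proj₂ ∘ graphic)) ,
  λ P′ R′ → Pᵢ R′ , Rᵢ R′ , obtainedByGluing R′
  where
  module Pieces {P′} (R′ : Represents (addRow M b) P′) =
    Split blocks connected nonzero R′
  open Pieces using (obtainedByGluing; module Piece)
  open module Piece′ {P′} (R′ : Represents (addRow M b) P′) =
    Pieces.Piece R′ using (Pᵢ; Rᵢ)
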